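{- For all $n\ge1$, the multiplexer function $\mathsf{MUX}_n$ has a hazard-free De Morgan formula of size $2\cdot3^n-1$ and depth $3n$.
   Context: $\mathsf{MUX}_n\colon\{0,1\}^{n+2^n}\to\{0,1\}$ is $\mathsf{MUX}_n(s_1,\dots,s_n,x_0,\dots,x_{2^n-1})=x_{\mathrm{bin}(s_1,\dots,s_n)}$, where $\mathrm{bin}(s_1,\dots,s_n)$ is the natural number with binary representation $s_1s_2\cdots s_n$. Three-valued logic: let $\mathsf u$ be a third symbol, thought of as $\tfrac12$, so $0<\mathsf u<1$; $x\wedge y=\min(x,y)$, $x\vee y=\max(x,y)$, $\neg x=1-x$ on $\{0,\mathsf u,1\}$. A resolution of $\alpha\in\{0,\mathsf u,1\}^m$ is a string $a\in\{0,1\}^m$ with $a_i=\alpha_i$ whenever $\alpha_i\ne\mathsf u$. The hazard-free extension $\tilde f$ of $f\colon\{0,1\}^m\to\{0,1\}$ is: $\tilde f(\alpha)=c\in\{0,1\}$ if $f(a)=c$ for all resolutions $a$ of $\alpha$, and $\tilde f(\alpha)=\mathsf u$ otherwise. A De Morgan formula is a binary tree whose internal nodes are labeled $\vee$ or $\wedge$ (fan-in two) and whose leaves are labeled by literals (a variable or its negation), evaluated on $\{0,\mathsf u,1\}$-inputs by the rules above. Size is the number of leaves; depth is the length (number of edges) of the longest root-to-leaf path. A formula $F$ computing $f$ is hazard-free if $F(\alpha)=\tilde f(\alpha)$ for all $\alpha\in\{0,\mathsf u,1\}^m$. -}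

module Defs where

open import Data.Bool using (Bool; true; false; if_then_else_)
import Data.Bool.Properties as Bool
open import Data.Fin using (Fin; fromℕ<)
import Data.Fin.Properties as Fin
open import Data.Nat using (ℕ; zero; suc; _+_; _^_; _⊔_; _<_; z<s)
open import Data.Nat.Properties using (+-monoʳ-<; <-≤-trans; m≤m+n; +-identityʳ)
open import Data.Product using (_,_)
open import Data.Vec using (Vec; []; _∷_; lookup; map; take; drop)
open import Relation.Binary.Definitions using (DecidableEquality)
open import Relation.Binary.PropositionalEquality using (_≡_; _≢_; refl; sym; subst)
open import Relation.Nullary using (Dec; yes; no; does; ¬?; _→-dec_; map′; _×-dec_)
open import Relation.Unary using (Decidable)

-- Bits are read most significant first.
bin : ∀ {n} → Vec Bool n → ℕ
bin             []          = 0
bin             (false ∷ s) = bin s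
bin {n = suc n} (true  ∷ s) = 2 ^ n + bin s

bin<2^n : ∀ {n} (s : Vec Bool n) → bin s < 2 ^ n
bin<2^n             []          = z<s
bin<2^n {n = suc n} (false ∷ s) = <-≤-trans (bin<2^n s) (m≤m+n (2 ^ n) _)
bin<2^n {n = suc n} (true  ∷ s) =
  +-monoʳ-< (2 ^ n) (subst (bin s <_) (sym (+-identityʳ (2 ^ n))) (bin<2^n s))

-- The input lists the n selector bits s₁ … sₙ, followed by x₀ … x_{2ⁿ-1}.
MUX : ∀ n → Vec Bool (n + 2 ^ n) → Bool
MUX n v = lookup (drop n v) (fromℕ< (bin<2^n (take n v)))

data Trit : Set where
  𝟎 𝐮 𝟏 : Trit

infixr 6 _∧₃_
infixr 5 _∨₃_

-- Minimum and maximum for the order 𝟎 < 𝐮 < 𝟏.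
_∧₃_ : Trit → Trit → Trit
𝟎 ∧₃ _ = 𝟎
𝐮 ∧₃ 𝟎 = 𝟎
𝐮 ∧₃ 𝐮 = 𝐮
𝐮 ∧₃ 𝟏 = 𝐮
𝟏 ∧₃ y = y

_∨₃_ : Trit → Trit → Trit
𝟎 ∨₃ y = y
𝐮 ∨₃ 𝟎 = 𝐮
𝐮 ∨₃ 𝐮 = 𝐮
𝐮 ∨₃ 𝟏 = 𝟏
𝟏 ∨₃ _ = 𝟏

¬₃_ : Trit → Trit
¬₃ 𝟎 = 𝟏
¬₃ 𝐮 = 𝐮
¬₃ 𝟏 = 𝟎

_≟₃_ : DecidableEquality Trit
𝟎 ≟₃ 𝟎 = yes refl
𝟎 ≟₃ 𝐮 = no λ ()
𝟎 ≟₃ 𝟏 = no λ ()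
𝐮 ≟₃ 𝟎 = no λ ()
𝐮 ≟₃ 𝐮 = yes refl
𝐮 ≟₃ 𝟏 = no λ ()
𝟏 ≟₃ 𝟎 = no λ ()
𝟏 ≟₃ 𝐮 = no λ ()
𝟏 ≟₃ 𝟏 = yes refl

toTrit : Bool → Trit
toTrit false = 𝟎
toTrit true  = 𝟏

_IsResolutionOf_ : ∀ {m} → Vec Bool m → Vec Trit m → Set
a IsResolutionOf α = ∀ i → lookup α i ≢ 𝐮 → toTrit (lookup a i) ≡ lookup α i

ConstantOnResolutions : ∀ {m} → (Vec Bool m → Bool) → Vec Trit m → Bool → Set
ConstantOnResolutions f α c = ∀ a → a IsResolutionOf α → f a ≡ c

isResolutionOf? : ∀ {m} (a : Vec Bool m) (α : Vec Trit m) → Dec (a IsResolutionOf α)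
isResolutionOf? a α =
  Fin.all? λ i → ¬? (lookup α i ≟₃ 𝐮) →-dec (toTrit (lookup a i) ≟₃ lookup α i)

allBits? : ∀ {m} {P : Vec Bool m → Set} → Decidable P → Dec (∀ a → P a)
allBits? {m = zero}  P? = map′ (λ { p [] → p }) (λ h → h []) (P? [])
allBits? {m = suc m} P? =
  map′ (λ { (p , q) (false ∷ a) → p a ; (p , q) (true ∷ a) → q a })
       (λ h → (λ a → h (false ∷ a)) , (λ a → h (true ∷ a)))
       (allBits? (λ a → P? (false ∷ a)) ×-dec allBits? (λ a → P? (true ∷ a)))

constantOnResolutions? : ∀ {m} (f : Vec Bool m → Bool) (α : Vec Trit m) (c : Bool) →
                         Dec (ConstantOnResolutions f α c)
constantOnResolutions? f α c =
  allBits? λ a → isResolutionOf? a α →-dec (f a Bool.≟ c)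

-- Every α has a resolution, so the two tests cannot both succeed and their
-- order is immaterial.
hazardFreeExtension : ∀ {m} → (Vec Bool m → Bool) → Vec Trit m → Trit
hazardFreeExtension f α =
  if does (constantOnResolutions? f α false) then 𝟎 else
  if does (constantOnResolutions? f α true)  then 𝟏 else 𝐮

data Literal (m : ℕ) : Set where
  pos neg : Fin m → Literal m

data Formula (m : ℕ) : Set where
  leaf    : Literal m → Formula m
  and or  : Formula m → Formula m → Formula m

size : ∀ {m} → Formula m → ℕ
size (leaf _)  = 1
size (and F G) = size F + size G
size (or  F G) = size F + size G

depth : ∀ {m} → Formula m → ℕ
depth (leaf _)  = 0
depth (and F G) = suc (depth F ⊔ depth G)
depth (or  F G) = suc (depth F ⊔ depth G)

evalLiteral : ∀ {m} → Literal m → Vec Trit m → Trit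
evalLiteral (pos i) α = lookup α i
evalLiteral (neg i) α = ¬₃ lookup α i

eval : ∀ {m} → Formula m → Vec Trit m → Trit
eval (leaf l)  α = evalLiteral l α
eval (and F G) α = eval F α ∧₃ eval G α
eval (or  F G) α = eval F α ∨₃ eval G α

Computes : ∀ {m} → Formula m → (Vec Bool m → Bool) → Set
Computes F f = ∀ a → eval F (map toTrit a) ≡ toTrit (f a)

HazardFree : ∀ {m} → Formula m → (Vec Bool m → Bool) → Set
HazardFree F f = ∀ α → eval F α ≡ hazardFreeExtension f α

{-# OPTIONS --safe #-}
-- The formula is built by recursion on the number of selectors, from the size-5
-- hazard-free formula
--   (¬ s ∧ x₀) ∨ (x₁ ∧ (s ∨ x₀))
-- for MUX₁, with the multiplexers of the lower and upper halves of the data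
-- substituted for x₀ and x₁.  The substitution preserves hazard-freeness because
-- the output is a bit c exactly when each data input that the selector may still
-- choose equals c.
module Submission where

open import Data.Bool using (Bool; true; false; not)
open import Data.Bool.Properties using (not-¬)
open import Data.Empty using (⊥-elim)
open import Data.Fin using (Fin; zero; suc; _↑ˡ_; _↑ʳ_; fromℕ<)
open import Data.Nat using (ℕ; zero; suc; _+_; _*_; _∸_; _^_; _≤_)
open import Data.Nat.Properties using (m≤n⇒m⊔n≡n; n≤1+n; *-suc)
open import Data.Nat.Tactic.RingSolver using (solve-∀)
open import Data.Product using (Σ-syntax; _×_; _,_; proj₁; proj₂)
open import Data.Vec using (Vec; []; _∷_; lookup; map; take; drop; tabulate; _++_)
open import Data.Vec.Properties
  using (lookup-map; lookup∘tabulate; lookup-++ˡ; lookup-++ʳ; take++drop≡id; ++-injective)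
open import Function using (_∘_; case_of_; _⇔_; mk⇔; Equivalence)
open import Relation.Binary.PropositionalEquality
  using (_≡_; _≢_; refl; sym; trans; cong; cong₂; subst; module ≡-Reasoning)
open import Relation.Nullary using (yes; no)
open import Defs

open Equivalence using (to; from)

toTrit≢𝐮 : ∀ b → toTrit b ≢ 𝐮
toTrit≢𝐮 false ()
toTrit≢𝐮 true  ()

toTrit-injective : ∀ {b c} → toTrit b ≡ toTrit c → b ≡ c
toTrit-injective {false} {false} _ = refl
toTrit-injective {true}  {true}  _ = refl

-- The condition that `_IsResolutionOf_` imposes at one coordinate. For a selector trit it says that
-- branch `b` is still possible.
Resolves : Bool → Trit → Set
Resolves b t = t ≢ 𝐮 → toTrit b ≡ t

resolves-𝐮 : ∀ b → Resolves b 𝐮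
resolves-𝐮 b 𝐮≢𝐮 = ⊥-elim (𝐮≢𝐮 refl)

resolves-toTrit : ∀ b → Resolves b (toTrit b)
resolves-toTrit b _ = refl

++-isResolutionOf : ∀ {m n} (s : Vec Bool m) {x : Vec Bool n} (α : Vec Trit (m + n)) →
                    (∀ k → Resolves (lookup s k) (lookup α (k ↑ˡ n))) →
                    (∀ j → Resolves (lookup x j) (lookup α (m ↑ʳ j))) →
                    (s ++ x) IsResolutionOf α
++-isResolutionOf []      α       p q i       = q i
++-isResolutionOf (_ ∷ _) (_ ∷ _) p q zero    = p zero
++-isResolutionOf (_ ∷ s) (_ ∷ α) p q (suc i) = ++-isResolutionOf s α (p ∘ suc) q i

resolveTo : Bool → Trit → Bool
resolveTo c 𝟎 = false
resolveTo c 𝐮 = c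
resolveTo c 𝟏 = true

resolveTo-resolves : ∀ c t → Resolves (resolveTo c t) t
resolveTo-resolves c 𝟎 = resolves-toTrit false
resolveTo-resolves c 𝐮 = resolves-𝐮 c
resolveTo-resolves c 𝟏 = resolves-toTrit true

-- An unstable `t` would come out as `not c`, so the outcome `c` can only stem from a stable `t`.
resolveTo-not : ∀ c t → resolveTo (not c) t ≡ c → t ≡ toTrit c
resolveTo-not c 𝟎 refl = refl
resolveTo-not c 𝐮 eq   = ⊥-elim (not-¬ refl (sym eq))
resolveTo-not c 𝟏 refl = refl

isResolutionOf-map-toTrit : ∀ {m} {a a′ : Vec Bool m} → a′ IsResolutionOf map toTrit a → a′ ≡ a
isResolutionOf-map-toTrit {a = []}    {[]}     _ = refl
isResolutionOf-map-toTrit {a = b ∷ _} {_ ∷ _} r =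
  cong₂ _∷_ (toTrit-injective (r zero (toTrit≢𝐮 b))) (isResolutionOf-map-toTrit (r ∘ suc))

map-toTrit-isResolutionOf : ∀ {m} (a : Vec Bool m) → a IsResolutionOf map toTrit a
map-toTrit-isResolutionOf a i _ = sym (lookup-map i toTrit a)

-- A trit is determined by which bits it equals, and a trit equal to neither is `𝐮`. Hazard-freeness
-- thus reduces to deciding when the output is a given bit.
hazardFreeExtension-unique : ∀ {m} (f : Vec Bool m → Bool) (α : Vec Trit m) {t : Trit} →
                             (∀ c → t ≡ toTrit c ⇔ ConstantOnResolutions f α c) →
                             t ≡ hazardFreeExtension f α
hazardFreeExtension-unique f α {t} char
  with constantOnResolutions? f α false | constantOnResolutions? f α true
... | yes p | _     = from (char false) p
... | no _  | yes q = from (char true) q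
... | no ¬p | no ¬q = other t (¬p ∘ to (char false)) (¬q ∘ to (char true))
  where
  other : ∀ t → t ≢ 𝟎 → t ≢ 𝟏 → t ≡ 𝐮
  other 𝟎 t≢𝟎 _   = ⊥-elim (t≢𝟎 refl)
  other 𝐮 _   _   = refl
  other 𝟏 _   t≢𝟏 = ⊥-elim (t≢𝟏 refl)

-- A fully stable input has itself as its only resolution.
hazardFreeExtension-toTrit : ∀ {m} (f : Vec Bool m → Bool) (a : Vec Bool m) →
                             hazardFreeExtension f (map toTrit a) ≡ toTrit (f a)
hazardFreeExtension-toTrit f a = sym (hazardFreeExtension-unique f (map toTrit a) λ c → mk⇔
  (λ fa≡c a′ r → trans (cong f (isResolutionOf-map-toTrit r)) (toTrit-injective fa≡c))
  (λ const → cong toTrit (const a (map-toTrit-isResolutionOf a))))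

hazardFree⇒computes : ∀ {m} (F : Formula m) {f : Vec Bool m → Bool} →
                      HazardFree F f → Computes F f
hazardFree⇒computes F {f} hf a = trans (hf (map toTrit a)) (hazardFreeExtension-toTrit f a)

-- Distributing the second conjunction gives `x₁ ∧₃ s` and the consensus term `x₁ ∧₃ x₀`, which
-- keeps the output at `𝟏` when both data are `𝟏` and `s` is `𝐮`.
mux₃ : Trit → Trit → Trit → Trit
mux₃ s x₀ x₁ = ((¬₃ s) ∧₃ x₀) ∨₃ (x₁ ∧₃ (s ∨₃ x₀))

mux₃-𝟎 : ∀ x₀ x₁ → mux₃ 𝟎 x₀ x₁ ≡ x₀
mux₃-𝟎 𝟎 𝟎 = refl
mux₃-𝟎 𝟎 𝐮 = refl
mux₃-𝟎 𝟎 𝟏 = refl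
mux₃-𝟎 𝐮 𝟎 = refl
mux₃-𝟎 𝐮 𝐮 = refl
mux₃-𝟎 𝐮 𝟏 = refl
mux₃-𝟎 𝟏 _ = refl

mux₃-𝟏 : ∀ x₀ x₁ → mux₃ 𝟏 x₀ x₁ ≡ x₁
mux₃-𝟏 _ 𝟎 = refl
mux₃-𝟏 _ 𝐮 = refl
mux₃-𝟏 _ 𝟏 = refl

mux₃-𝐮 : ∀ x₀ x₁ c → mux₃ 𝐮 x₀ x₁ ≡ toTrit c → x₀ ≡ toTrit c × x₁ ≡ toTrit c
mux₃-𝐮 𝟎 𝟎 c p = p , p
mux₃-𝐮 𝐮 𝐮 c p = p , p
mux₃-𝐮 𝟏 𝟏 c p = p , p
mux₃-𝐮 𝟎 𝐮 c p = ⊥-elim (toTrit≢𝐮 c (sym p))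
mux₃-𝐮 𝟎 𝟏 c p = ⊥-elim (toTrit≢𝐮 c (sym p))
mux₃-𝐮 𝐮 𝟎 c p = ⊥-elim (toTrit≢𝐮 c (sym p))
mux₃-𝐮 𝐮 𝟏 c p = ⊥-elim (toTrit≢𝐮 c (sym p))
mux₃-𝐮 𝟏 𝟎 c p = ⊥-elim (toTrit≢𝐮 c (sym p))
mux₃-𝐮 𝟏 𝐮 c p = ⊥-elim (toTrit≢𝐮 c (sym p))

mux₃-𝐮-idem : ∀ c → mux₃ 𝐮 (toTrit c) (toTrit c) ≡ toTrit c
mux₃-𝐮-idem false = refl
mux₃-𝐮-idem true  = refl

mux₃-≡-toTrit : ∀ s x₀ x₁ c → mux₃ s x₀ x₁ ≡ toTrit c ⇔
                ((Resolves false s → x₀ ≡ toTrit c) × (Resolves true s → x₁ ≡ toTrit c))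
mux₃-≡-toTrit 𝟎 x₀ x₁ c rewrite mux₃-𝟎 x₀ x₁ = mk⇔
  -- The other branch is impossible: since `𝟎` is stable, `r` would yield `𝟏 ≡ 𝟎`.
  (λ p → (λ _ → p) , λ r → case r (λ ()) of λ ())
  (λ (h , _) → h (resolves-toTrit false))
mux₃-≡-toTrit 𝟏 x₀ x₁ c rewrite mux₃-𝟏 x₀ x₁ = mk⇔
  (λ p → (λ r → case r (λ ()) of λ ()) , λ _ → p)
  (λ (_ , h) → h (resolves-toTrit true))
mux₃-≡-toTrit 𝐮 x₀ x₁ c = mk⇔
  (λ p → let p₀ , p₁ = mux₃-𝐮 x₀ x₁ c p in (λ _ → p₀) , (λ _ → p₁))
  (λ (h₀ , h₁) → trans (cong₂ (mux₃ 𝐮) (h₀ (resolves-𝐮 false)) (h₁ (resolves-𝐮 true)))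
                       (mux₃-𝐮-idem c))

-- Data inputs are addressed by bit vectors, so that the two halves of the data
-- are d ∘ (false ∷_) and d ∘ (true ∷_).
muxFormula : ∀ {m} n → (Fin n → Fin m) → (Vec Bool n → Fin m) → Formula m
muxFormula zero    sel d = leaf (pos (d []))
muxFormula (suc n) sel d =
  or (and (leaf (neg (sel zero))) lower) (and upper (or (leaf (pos (sel zero))) lower))
  where
  lower = muxFormula n (sel ∘ suc) (d ∘ (false ∷_))
  upper = muxFormula n (sel ∘ suc) (d ∘ (true ∷_))

-- With `lower` used twice, `upper` once and two selector leaves, the size plus one exactly triples
-- at each level.
suc-size-muxFormula : ∀ {m} n (sel : Fin n → Fin m) d → suc (size (muxFormula n sel d)) ≡ 2 * 3 ^ n
suc-size-muxFormula zero    sel d = refl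
suc-size-muxFormula (suc n) sel d = begin
  suc ((1 + l) + (u + (1 + l)))   ≡⟨ rearrange l u ⟩
  suc l + suc u + suc l           ≡⟨ cong₂ (λ a b → a + b + a) (ih _) (ih _) ⟩
  2 * k + 2 * k + 2 * k           ≡⟨ triple k ⟩
  2 * (3 * k)                     ∎
  where
  open ≡-Reasoning
  k = 3 ^ n
  ih = suc-size-muxFormula n (sel ∘ suc)
  l = size (muxFormula n (sel ∘ suc) (d ∘ (false ∷_)))
  u = size (muxFormula n (sel ∘ suc) (d ∘ (true ∷_)))
  rearrange : ∀ l u → suc ((1 + l) + (u + (1 + l))) ≡ suc l + suc u + suc l
  rearrange = solve-∀
  triple : ∀ k → 2 * k + 2 * k + 2 * k ≡ 2 * (3 * k)
  triple = solve-∀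

depth-muxFormula : ∀ {m} n (sel : Fin n → Fin m) d → depth (muxFormula n sel d) ≡ 3 * n
depth-muxFormula zero    sel d = refl
depth-muxFormula (suc n) sel d
  rewrite depth-muxFormula n (sel ∘ suc) (d ∘ (false ∷_))
        | depth-muxFormula n (sel ∘ suc) (d ∘ (true ∷_))
        -- The deepest path runs through the second copy of `lower`, three edges down. Simplifying
        -- the inner maximum turns the outer one into the same form, hence the repeated rewrite.
        | m≤n⇒m⊔n≡n (n≤1+n (3 * n))
        | m≤n⇒m⊔n≡n (n≤1+n (3 * n)) = sym (*-suc 3 n)

-- Induction on `n`, with the first bit of `s` choosing the half. `sel` and `d` stay arbitrary
-- because the recursion drops a selector and restricts `d`.
eval-muxFormula : ∀ {m} n (sel : Fin n → Fin m) d α c →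
  eval (muxFormula n sel d) α ≡ toTrit c ⇔
  (∀ s → (∀ k → Resolves (lookup s k) (lookup α (sel k))) → lookup α (d s) ≡ toTrit c)
eval-muxFormula zero    sel d α c = mk⇔ (λ { p [] _ → p }) (λ h → h [] λ ())
eval-muxFormula (suc n) sel d α c = mk⇔
  (λ { p (false ∷ s) r → to (ih _) (proj₁ (to step p) (r zero)) s (r ∘ suc)
     ; p (true  ∷ s) r → to (ih _) (proj₂ (to step p) (r zero)) s (r ∘ suc) })
  (λ h → from step
    ( (λ r → from (ih _) λ s rs → h (false ∷ s) λ { zero → r ; (suc k) → rs k })
    , (λ r → from (ih _) λ s rs → h (true  ∷ s) λ { zero → r ; (suc k) → rs k })))
  where
  ih = λ d′ → eval-muxFormula n (sel ∘ suc) d′ α c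
  step = mux₃-≡-toTrit (lookup α (sel zero))
           (eval (muxFormula n (sel ∘ suc) (d ∘ (false ∷_))) α)
           (eval (muxFormula n (sel ∘ suc) (d ∘ (true ∷_))) α) c

MUX-++ : ∀ {n} (s : Vec Bool n) (x : Vec Bool (2 ^ n)) →
         MUX n (s ++ x) ≡ lookup x (fromℕ< (bin<2^n s))
MUX-++ {n} s x =
  let take≡s , drop≡x = ++-injective (take n (s ++ x)) s (take++drop≡id n (s ++ x))
  in cong₂ (λ s x → lookup x (fromℕ< (bin<2^n s))) take≡s drop≡x

-- Forward, the selector bits of a resolution form an admissible `s`; the datum it addresses is
-- stable with value `c`, so the resolution must copy it.
MUX-constantOnResolutions : ∀ n (α : Vec Trit (n + 2 ^ n)) c →
  (∀ s → (∀ k → Resolves (lookup s k) (lookup α (k ↑ˡ 2 ^ n))) →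
         lookup α (n ↑ʳ fromℕ< (bin<2^n s)) ≡ toTrit c) ⇔
  ConstantOnResolutions (MUX n) α c
MUX-constantOnResolutions n α c = mk⇔ constant selected
  where
  constant : (∀ s → (∀ k → Resolves (lookup s k) (lookup α (k ↑ˡ 2 ^ n))) →
                    lookup α (n ↑ʳ fromℕ< (bin<2^n s)) ≡ toTrit c) →
             ConstantOnResolutions (MUX n) α c
  constant h a r = toTrit-injective (begin
    toTrit (lookup x i)               ≡⟨ cong toTrit (lookup-++ʳ s x i) ⟨
    toTrit (lookup (s ++ x) (n ↑ʳ i)) ≡⟨ r′ (n ↑ʳ i) (toTrit≢𝐮 c ∘ trans (sym αᵢ≡c)) ⟩
    lookup α (n ↑ʳ i)                 ≡⟨ αᵢ≡c ⟩
    toTrit c                          ∎)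
    where
    open ≡-Reasoning
    s = take n a
    x = drop n a
    i = fromℕ< (bin<2^n s)
    r′ : (s ++ x) IsResolutionOf α
    r′ = subst (_IsResolutionOf α) (sym (take++drop≡id n a)) r
    αᵢ≡c : lookup α (n ↑ʳ i) ≡ toTrit c
    αᵢ≡c = h s λ k →
      subst (λ b → Resolves b (lookup α (k ↑ˡ 2 ^ n))) (lookup-++ˡ s x k) (r′ (k ↑ˡ 2 ^ n))

  -- Resolving every unstable data input to ¬ c forces the selected one to be c already.
  selected : ConstantOnResolutions (MUX n) α c →
             ∀ s → (∀ k → Resolves (lookup s k) (lookup α (k ↑ˡ 2 ^ n))) →
             lookup α (n ↑ʳ fromℕ< (bin<2^n s)) ≡ toTrit c
  selected const s r = resolveTo-not c _ (begin
    resolveTo (not c) (lookup α (n ↑ʳ i)) ≡⟨ lookup∘tabulate _ i ⟨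
    lookup x i                            ≡⟨ MUX-++ s x ⟨
    MUX n (s ++ x)                        ≡⟨ const (s ++ x) (++-isResolutionOf s α r x-resolves) ⟩
    c                                     ∎)
    where
    open ≡-Reasoning
    i = fromℕ< (bin<2^n s)
    x = tabulate λ j → resolveTo (not c) (lookup α (n ↑ʳ j))
    x-resolves : ∀ j → Resolves (lookup x j) (lookup α (n ↑ʳ j))
    x-resolves j = subst (λ b → Resolves b _) (sym (lookup∘tabulate _ j)) (resolveTo-resolves (not c) _)

theorem5p8 : ∀ (n : ℕ) → 1 ≤ n →
    Σ[ F ∈ Formula (n + 2 ^ n) ] Computes F (MUX n) × HazardFree F (MUX n)
    × size F ≡ 2 * 3 ^ n ∸ 1 × depth F ≡ 3 * n
theorem5p8 n _ =
  F , hazardFree⇒computes F hazardFree , hazardFree ,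
  -- `suc (size F) ∸ 1` reduces to `size F`.
  cong (_∸ 1) (suc-size-muxFormula n sel datum) , depth-muxFormula n sel datum
  where
  sel : Fin n → Fin (n + 2 ^ n)
  sel = _↑ˡ 2 ^ n
  datum : Vec Bool n → Fin (n + 2 ^ n)
  datum s = n ↑ʳ fromℕ< (bin<2^n s)
  F = muxFormula n sel datum
  hazardFree : HazardFree F (MUX n)
  hazardFree α = hazardFreeExtension-unique (MUX n) α λ c →
    mk⇔ (to (MUX-constantOnResolutions n α c) ∘ to (eval-muxFormula n sel datum α c))
        (from (eval-muxFormula n sel datum α c) ∘ from (MUX-constantOnResolutions n α c))
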